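{- Let $p$ be a prime. There is no set $S\subseteq\mathbb{F}_p^2$ of cardinality divisible by $p$ that has exactly two special directions.
   Context: $\mathbb{F}_p$ is the field with $p$ elements. A direction is an equivalence class of nonzero vectors of $\mathbb{F}_p^2$ under multiplication by nonzero scalars; there are $p+1$ directions, and each corresponds to a class of $p$ parallel affine lines. A set $S\subseteq\mathbb{F}_p^2$ is equidistributed in a direction if all $p$ lines parallel to that direction intersect $S$ in the same number of points. A direction is called special for $S$ if $S$ is not equidistributed in it. -}

module Defs where

open import Data.Fin.Base using (Fin; toℕ; remQuot)
open import Data.Fin.Properties using (any?; _≟_)
open import Data.Fin.Subset using (Subset; _∩_; ∣_∣)
open import Data.Nat.Base using (ℕ; NonZero) renaming (_+_ to _+ℕ_; _*_ to _*ℕ_)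
open import Data.Nat.DivMod using (_mod_)
open import Data.Product.Base using (∃; ∃₂; _×_; _,_)
open import Data.Product.Properties using (≡-dec)
open import Data.Sum.Base using (_⊎_)
open import Data.Vec.Base using (tabulate)
open import Relation.Binary.PropositionalEquality using (_≡_; _≢_)
open import Relation.Nullary using (¬_; Dec; does)

-- The affine plane over ℤ/pℤ, which is the field 𝔽ₚ when p is prime.

module AffinePlane (p : ℕ) .{{_ : NonZero p}} where

  infixl 6 _+_ _⊕_
  infixl 7 _*_ _⊙_
  infix  4 _∼_

  𝔽 : Set
  𝔽 = Fin p

  0# : 𝔽
  0# = 0 mod p

  _+_ _*_ : 𝔽 → 𝔽 → 𝔽
  x + y = (toℕ x +ℕ toℕ y) mod p
  x * y = (toℕ x *ℕ toℕ y) mod p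

  Point : Set
  Point = 𝔽 × 𝔽

  0ᵥ : Point
  0ᵥ = 0# , 0#

  _⊕_ : Point → Point → Point
  (x₁ , x₂) ⊕ (y₁ , y₂) = (x₁ + y₁) , (x₂ + y₂)

  _⊙_ : 𝔽 → Point → Point
  c ⊙ (x₁ , x₂) = (c * x₁) , (c * x₂)

  -- Points are indexed by Fin (p * p) through the library bijection
  -- combine / remQuot, so that sets of points are library subsets: the
  -- point (x , y) belongs to S when combine x y ∈ S.

  PointSet : Set
  PointSet = Subset (p *ℕ p)

  -- A direction is given by a representative; two representatives are the
  -- same direction when they are related by _∼_.

  record Direction : Set where
    constructor direction
    field
      vector  : Point
      nonzero : vector ≢ 0ᵥ

  open Direction public

  _∼_ : Direction → Direction → Set
  d ∼ e = ∃ λ (c : 𝔽) → c ≢ 0# × vector e ≡ c ⊙ vector d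

  OnLine : Point → Direction → Point → Set
  OnLine a d x = ∃ λ (t : 𝔽) → x ≡ a ⊕ t ⊙ vector d

  onLine? : ∀ a d x → Dec (OnLine a d x)
  onLine? a d x = any? λ t → ≡-dec _≟_ _≟_ x (a ⊕ t ⊙ vector d)

  line : Point → Direction → PointSet
  line a d = tabulate λ i → does (onLine? a d (remQuot p i))

  -- Every line parallel to d is line a d for some a (in fact for p
  -- different a), so quantifying over base points covers all of them.

  Equidistributed : PointSet → Direction → Set
  Equidistributed S d = ∀ a b → ∣ S ∩ line a d ∣ ≡ ∣ S ∩ line b d ∣

  Special : PointSet → Direction → Set
  Special S d = ¬ Equidistributed S d

  ExactlyTwoSpecialDirections : PointSet → Set
  ExactlyTwoSpecialDirections S =
    ∃₂ λ d e → ¬ (d ∼ e) × Special S d × Special S e ×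
               (∀ f → Special S f → f ∼ d ⊎ f ∼ e)

{-# OPTIONS --safe #-}

-- If d and e are the only special directions, sum |S ∩ ℓ| over the lines ℓ
-- through the point x d + y e: the point itself is counted p times more often
-- than any other, while every direction but d and e contributes a constant.
-- Hence, up to constants, p times the indicator of S at x d + y e is A(y) + B(x),
-- where A and B are the line counts in the directions d and e. A function of this
-- form that takes only two values cannot depend on both coordinates.

module Submission where

open import Defs
open import Algebra.Bundles using (CommutativeSemiring)
import Algebra.Properties.Semiring.Sum as SemiringSum
import Algebra.Solver.Ring.NaturalCoefficients.Default as SemiringSolver
open import Algebra.Structures.Biased using (isCommutativeSemiringˡ; isCommutativeMonoidˡ)
open import Data.Bool.Base using (Bool; true; false; if_then_else_; _∧_)
open import Data.Fin.Base using (Fin; zero; suc; toℕ; combine; remQuot; punchIn; punchOut)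
open import Data.Fin.Permutation using (Permutation; permutation)
open import Data.Fin.Properties
  using (any?; _≟_; injective⇒≤; punchOut-injective; punchInᵢ≢i; toℕ<n; toℕ-fromℕ<; toℕ-injective;
         fromℕ<-cong; combine-injective; combine-remQuot; remQuot-combine)
open import Data.Fin.Subset using (Subset; _∩_; ∣_∣)
open import Data.Nat.Base as ℕ using (ℕ; NonZero; suc; zero)
open import Data.Nat.Divisibility using (_∣_; m%n≡0⇒n∣m; n∣m⇒m%n≡0)
open import Data.Nat.DivMod
  using (_mod_; _%_; m%n<n; m<n⇒m%n≡m; %-distribˡ-+; %-distribˡ-*; n%n≡0)
open import Data.Nat.Primality using (Prime; euclidsLemma; prime⇒nonTrivial)
import Data.Nat.Properties as ℕₚ
open import Data.Nat.Solver using (module +-*-Solver)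
open import Data.Product.Base using (∃; ∃₂; _×_; _,_; proj₁; proj₂; uncurry)
open import Data.Product.Properties using (≡-dec)
open import Data.Sum.Base using (_⊎_; inj₁; inj₂)
open import Data.Vec.Base using ([]; _∷_; lookup; tabulate)
open import Data.Vec.Properties using (lookup-zipWith; lookup∘tabulate)
open import Function.Base using (_∘_)
open import Function.Definitions using (Injective)
open import Relation.Binary.PropositionalEquality
open import Relation.Nullary using (¬_; Dec; yes; no; does; contradiction)
open import Relation.Nullary.Decidable using (decidable-stable; dec-true; dec-false)
open import Relation.Unary using (Decidable)

open SemiringSum ℕₚ.+-*-semiring
  using (sum; sum-syntax; sum-cong-≗; sum-remove; sum-permute; sum-replicate-zero;
         ∑-comm; *-distribˡ-sum)

open ≡-Reasoning

-- Sums over finite sets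

-- Pigeonhole: punching out a missed value would inject `Fin (suc n)` into `Fin n`. Field inverses
-- and the spanning of the plane by two independent vectors both come from this.
injective⇒surjective : ∀ {n} {f : Fin n → Fin n} → Injective _≡_ _≡_ f →
                       ∀ i → ∃ λ j → f j ≡ i
injective⇒surjective {suc n} {f} inj i with any? (λ j → f j ≟ i)
... | yes fj≡i = fj≡i
... | no  ∄fj≡i = contradiction
  (injective⇒≤ λ eq → inj (punchOut-injective (i≢f _) (i≢f _) eq)) ℕₚ.1+n≰n
  where
  i≢f : ∀ j → i ≢ f j
  i≢f j i≡fj = ∄fj≡i (j , sym i≡fj)

sum-reindex : ∀ {n} {f : Fin n → Fin n} → Injective _≡_ _≡_ f →
              ∀ (g : Fin n → ℕ) → ∑[ i < n ] g (f i) ≡ sum g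
sum-reindex {n} {f} inj g = sym (sum-permute g π)
  where
  f⁻¹ : Fin n → Fin n
  f⁻¹ = proj₁ ∘ injective⇒surjective inj
  f∘f⁻¹ : ∀ i → f (f⁻¹ i) ≡ i
  f∘f⁻¹ = proj₂ ∘ injective⇒surjective inj
  π : Permutation n n
  π = permutation f f⁻¹ f∘f⁻¹ (λ i → inj (f∘f⁻¹ (f i)))

-- Each exceptional term is added to the opposite sum, which avoids subtraction in ℕ.
sum-agree-except : ∀ {n} (f g : Fin n → ℕ) i → (∀ j → j ≢ i → f j ≡ g j) →
                   sum f ℕ.+ g i ≡ sum g ℕ.+ f i
sum-agree-except {suc n} f g i f≗g = begin
  sum f ℕ.+ g i            ≡⟨ cong (ℕ._+ g i) (sum-remove {i = i} f) ⟩
  f i ℕ.+ Σf ℕ.+ g i       ≡⟨ cong (λ s → f i ℕ.+ s ℕ.+ g i)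
                                (sum-cong-≗ λ j → f≗g (punchIn i j) (punchInᵢ≢i i j)) ⟩
  f i ℕ.+ Σg ℕ.+ g i       ≡⟨ +-*-Solver.solve 3 (λ a b c → a :+ b :+ c := c :+ b :+ a) refl
                                (f i) Σg (g i) ⟩
  g i ℕ.+ Σg ℕ.+ f i       ≡⟨ cong (ℕ._+ f i) (sum-remove {i = i} g) ⟨
  sum g ℕ.+ f i            ∎
  where
  open +-*-Solver using (_:+_; _:=_)
  Σf Σg : ℕ
  Σf = ∑[ j < n ] f (punchIn i j)
  Σg = ∑[ j < n ] g (punchIn i j)

sum-const : ∀ n c → ∑[ i < n ] c ≡ n ℕ.* c
sum-const zero    c = refl
sum-const (suc n) c = cong (c ℕ.+_) (sum-const n c)

-- Indicators and cardinalities

𝟙 : Bool → ℕ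
𝟙 b = if b then 1 else 0

𝟙-∧ : ∀ a b → 𝟙 (a ∧ b) ≡ 𝟙 a ℕ.* 𝟙 b
𝟙-∧ true  b = sym (ℕₚ.+-identityʳ (𝟙 b))
𝟙-∧ false b = refl

sum-unique : ∀ {n} {P : Fin n → Set} (P? : Decidable P) (g : Fin n → ℕ) {j} →
             P j → (∀ i → P i → i ≡ j) →
             ∑[ i < n ] (g i ℕ.* 𝟙 (does (P? i))) ≡ g j
sum-unique {n} {P} P? g {j} Pj unique = begin
  sum f                   ≡⟨ ℕₚ.+-identityʳ (sum f) ⟨
  sum f ℕ.+ 0             ≡⟨ sum-agree-except f (λ _ → 0) j f≗0 ⟩
  ∑[ i < n ] 0 ℕ.+ f j    ≡⟨ cong (ℕ._+ f j) (sum-replicate-zero n) ⟩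
  g j ℕ.* 𝟙 (does (P? j)) ≡⟨ cong (λ b → g j ℕ.* 𝟙 b) (dec-true (P? j) Pj) ⟩
  g j ℕ.* 1               ≡⟨ ℕₚ.*-identityʳ (g j) ⟩
  g j                     ∎
  where
  f : Fin n → ℕ
  f i = g i ℕ.* 𝟙 (does (P? i))
  f≗0 : ∀ i → i ≢ j → f i ≡ 0
  f≗0 i i≢j = trans (cong (λ b → g i ℕ.* 𝟙 b) (dec-false (P? i) (i≢j ∘ unique i)))
                    (ℕₚ.*-zeroʳ (g i))

𝟙-any? : ∀ {n} {P : Fin n → Set} (P? : Decidable P) → (∀ i j → P i → P j → i ≡ j) →
         𝟙 (does (any? P?)) ≡ ∑[ i < n ] 𝟙 (does (P? i))
𝟙-any? {n} P? unique = helper (any? P?)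
  where
  helper : (any : Dec _) → 𝟙 (does any) ≡ ∑[ i < n ] 𝟙 (does (P? i))
  helper (yes (j , Pj)) = sym (trans
    (sum-cong-≗ λ i → sym (ℕₚ.*-identityˡ (𝟙 (does (P? i)))))
    (sum-unique P? (λ _ → 1) Pj λ i Pi → unique i j Pi Pj))
  helper (no ∄P) = sym (trans
    (sum-cong-≗ λ i → cong 𝟙 (dec-false (P? i) (∄P ∘ (i ,_))))
    (sum-replicate-zero n))

∣s∣≡sum : ∀ {n} (s : Subset n) → ∣ s ∣ ≡ ∑[ i < n ] 𝟙 (lookup s i)
∣s∣≡sum []          = refl
∣s∣≡sum (true  ∷ s) = cong suc (∣s∣≡sum s)
∣s∣≡sum (false ∷ s) = ∣s∣≡sum s

-- Double counting of the pairs related by `R`, weighted by membership in `s`. `R` is kept apart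
-- from `i ≡ f j` because lines test equality of points, while subsets are indexed by numbers.
∣s∩image∣ : ∀ {m n} (s : Subset n) {f : Fin m → Fin n} → Injective _≡_ _≡_ f →
            {R : Fin n → Fin m → Set} (R? : ∀ i j → Dec (R i j)) →
            (∀ j → R (f j) j) → (∀ i j → R i j → i ≡ f j) →
            ∣ s ∩ tabulate (λ i → does (any? (R? i))) ∣ ≡ ∑[ j < m ] 𝟙 (lookup s (f j))
∣s∩image∣ {m} {n} s {f} inj R? Rf R⇒f = begin
  ∣ s ∩ image ∣                                              ≡⟨ ∣s∣≡sum (s ∩ image) ⟩
  ∑[ i < n ] 𝟙 (lookup (s ∩ image) i)                        ≡⟨ sum-cong-≗ pointwise ⟩
  ∑[ i < n ] ∑[ j < m ] (𝟙 (lookup s i) ℕ.* 𝟙 (does (R? i j))) ≡⟨ ∑-comm {n} {m} _ ⟩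
  ∑[ j < m ] ∑[ i < n ] (𝟙 (lookup s i) ℕ.* 𝟙 (does (R? i j))) ≡⟨ sum-cong-≗ (λ j →
    sum-unique (λ i → R? i j) (𝟙 ∘ lookup s) (Rf j) (λ i → R⇒f i j)) ⟩
  ∑[ j < m ] 𝟙 (lookup s (f j))                              ∎
  where
  image : Subset n
  image = tabulate λ i → does (any? (R? i))
  pointwise : ∀ i → 𝟙 (lookup (s ∩ image) i) ≡
                    ∑[ j < m ] (𝟙 (lookup s i) ℕ.* 𝟙 (does (R? i j)))
  pointwise i = begin
    𝟙 (lookup (s ∩ image) i)                        ≡⟨ cong 𝟙 (lookup-zipWith _∧_ i s image) ⟩
    𝟙 (lookup s i ∧ lookup image i)                 ≡⟨ 𝟙-∧ (lookup s i) (lookup image i) ⟩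
    𝟙 (lookup s i) ℕ.* 𝟙 (lookup image i)           ≡⟨ cong (λ b → 𝟙 (lookup s i) ℕ.* 𝟙 b)
                                                         (lookup∘tabulate _ i) ⟩
    𝟙 (lookup s i) ℕ.* 𝟙 (does (any? (R? i)))       ≡⟨ cong (𝟙 (lookup s i) ℕ.*_)
      (𝟙-any? (R? i) λ j k Rij Rik → inj (trans (sym (R⇒f i j Rij)) (R⇒f i k Rik))) ⟩
    𝟙 (lookup s i) ℕ.* ∑[ j < m ] 𝟙 (does (R? i j)) ≡⟨ *-distribˡ-sum {m} (𝟙 (lookup s i)) _ ⟩
    ∑[ j < m ] (𝟙 (lookup s i) ℕ.* 𝟙 (does (R? i j))) ∎

-- The field with p elements

module PrimeField (p : ℕ) .{{_ : NonZero p}} (p-prime : Prime p) where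

  open AffinePlane p

  infix 8 -_

  1# : 𝔽
  1# = 1 mod p

  -_ : 𝔽 → 𝔽
  - x = (p ℕ.∸ toℕ x) mod p

  mod-cong : ∀ {m n} → m % p ≡ n % p → m mod p ≡ n mod p
  mod-cong {m} {n} eq = fromℕ<-cong (m % p) (n % p) eq (m%n<n m p) (m%n<n n p)

  toℕ-mod : ∀ n → toℕ (n mod p) ≡ n % p
  toℕ-mod n = toℕ-fromℕ< (m%n<n n p)

  toℕ-% : ∀ x → toℕ x % p ≡ toℕ x
  toℕ-% x = m<n⇒m%n≡m (toℕ<n x)

  mod-toℕ : ∀ x → toℕ x mod p ≡ x
  mod-toℕ x = toℕ-injective (trans (toℕ-mod (toℕ x)) (toℕ-% x))

  0%p≡0 : 0 % p ≡ 0
  0%p≡0 = m<n⇒m%n≡m (ℕ.>-nonZero⁻¹ p)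

  mod-+ : ∀ m n → m mod p + n mod p ≡ (m ℕ.+ n) mod p
  mod-+ m n = mod-cong (trans (cong₂ (λ a b → (a ℕ.+ b) % p) (toℕ-mod m) (toℕ-mod n))
                              (sym (%-distribˡ-+ m n p)))

  mod-* : ∀ m n → (m mod p) * (n mod p) ≡ (m ℕ.* n) mod p
  mod-* m n = mod-cong (trans (cong₂ (λ a b → (a ℕ.* b) % p) (toℕ-mod m) (toℕ-mod n))
                              (sym (%-distribˡ-* m n p)))

  -- Drops an inner reduction on the right; one on the left is first commuted to the right, as in
  -- `+-assoc`.
  +-modʳ : ∀ x n → x + n mod p ≡ (toℕ x ℕ.+ n) mod p
  +-modʳ x n = trans (cong (_+ n mod p) (sym (mod-toℕ x))) (mod-+ (toℕ x) n)

  *-modʳ : ∀ x n → x * (n mod p) ≡ (toℕ x ℕ.* n) mod p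
  *-modʳ x n = trans (cong (_* (n mod p)) (sym (mod-toℕ x))) (mod-* (toℕ x) n)

  +-comm : ∀ x y → x + y ≡ y + x
  +-comm x y = cong (_mod p) (ℕₚ.+-comm (toℕ x) (toℕ y))

  *-comm : ∀ x y → x * y ≡ y * x
  *-comm x y = cong (_mod p) (ℕₚ.*-comm (toℕ x) (toℕ y))

  +-assoc : ∀ x y z → (x + y) + z ≡ x + (y + z)
  +-assoc x y z = begin
    (x + y) + z                           ≡⟨ +-comm (x + y) z ⟩
    z + (x + y)                           ≡⟨ +-modʳ z _ ⟩
    (toℕ z ℕ.+ (toℕ x ℕ.+ toℕ y)) mod p   ≡⟨ cong (_mod p) (ℕₚ.+-comm (toℕ z) _) ⟩
    (toℕ x ℕ.+ toℕ y ℕ.+ toℕ z) mod p     ≡⟨ cong (_mod p) (ℕₚ.+-assoc (toℕ x) _ _) ⟩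
    (toℕ x ℕ.+ (toℕ y ℕ.+ toℕ z)) mod p   ≡⟨ +-modʳ x _ ⟨
    x + (y + z)                           ∎

  *-assoc : ∀ x y z → (x * y) * z ≡ x * (y * z)
  *-assoc x y z = begin
    (x * y) * z                           ≡⟨ *-comm (x * y) z ⟩
    z * (x * y)                           ≡⟨ *-modʳ z _ ⟩
    (toℕ z ℕ.* (toℕ x ℕ.* toℕ y)) mod p   ≡⟨ cong (_mod p) (ℕₚ.*-comm (toℕ z) _) ⟩
    (toℕ x ℕ.* toℕ y ℕ.* toℕ z) mod p     ≡⟨ cong (_mod p) (ℕₚ.*-assoc (toℕ x) _ _) ⟩
    (toℕ x ℕ.* (toℕ y ℕ.* toℕ z)) mod p   ≡⟨ *-modʳ x _ ⟨
    x * (y * z)                           ∎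

  +-identityˡ : ∀ x → 0# + x ≡ x
  +-identityˡ x = trans (+-comm 0# x)
    (trans (+-modʳ x 0) (trans (cong (_mod p) (ℕₚ.+-identityʳ (toℕ x))) (mod-toℕ x)))

  *-identityˡ : ∀ x → 1# * x ≡ x
  *-identityˡ x = trans (*-comm 1# x)
    (trans (*-modʳ x 1) (trans (cong (_mod p) (ℕₚ.*-identityʳ (toℕ x))) (mod-toℕ x)))

  zeroˡ : ∀ x → 0# * x ≡ 0#
  zeroˡ x = trans (*-comm 0# x)
    (trans (*-modʳ x 0) (cong (_mod p) (ℕₚ.*-zeroʳ (toℕ x))))

  distribʳ : ∀ x y z → (y + z) * x ≡ y * x + z * x
  distribʳ x y z = begin
    (y + z) * x                                         ≡⟨ *-comm (y + z) x ⟩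
    x * (y + z)                                         ≡⟨ *-modʳ x _ ⟩
    (toℕ x ℕ.* (toℕ y ℕ.+ toℕ z)) mod p                 ≡⟨ cong (_mod p) (ℕₚ.*-comm (toℕ x) _) ⟩
    ((toℕ y ℕ.+ toℕ z) ℕ.* toℕ x) mod p                 ≡⟨ cong (_mod p)
      (ℕₚ.*-distribʳ-+ (toℕ x) (toℕ y) _) ⟩
    (toℕ y ℕ.* toℕ x ℕ.+ toℕ z ℕ.* toℕ x) mod p         ≡⟨ mod-+ (toℕ y ℕ.* toℕ x) _ ⟨
    y * x + z * x                                       ∎

  -- Packaged for the solver. Negation stays opaque to it and is eliminated by `-‿inverseʳ`.
  commutativeSemiring : CommutativeSemiring _ _
  commutativeSemiring = record
    { Carrier = 𝔽 ; _≈_ = _≡_ ; _+_ = _+_ ; _*_ = _*_ ; 0# = 0# ; 1# = 1#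
    ; isCommutativeSemiring = isCommutativeSemiringˡ record
      { +-isCommutativeMonoid = isCommutativeMonoidˡ record
        { isSemigroup = record
          { isMagma = record { isEquivalence = isEquivalence ; ∙-cong = cong₂ _+_ }
          ; assoc   = +-assoc }
        ; identityˡ = +-identityˡ
        ; comm      = +-comm }
      ; *-isCommutativeMonoid = isCommutativeMonoidˡ record
        { isSemigroup = record
          { isMagma = record { isEquivalence = isEquivalence ; ∙-cong = cong₂ _*_ }
          ; assoc   = *-assoc }
        ; identityˡ = *-identityˡ
        ; comm      = *-comm }
      ; distribʳ = distribʳ
      ; zeroˡ    = zeroˡ }
    }

  open CommutativeSemiring commutativeSemiring public
    using (+-identityʳ; *-identityʳ; zeroʳ; distribˡ)
  open SemiringSolver commutativeSemiring public using (solve; _:+_; _:*_; _:=_)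

  -‿inverseʳ : ∀ x → x + - x ≡ 0#
  -‿inverseʳ x = begin
    x + - x                             ≡⟨ +-modʳ x _ ⟩
    (toℕ x ℕ.+ (p ℕ.∸ toℕ x)) mod p     ≡⟨ cong (_mod p) (ℕₚ.m+[n∸m]≡n (ℕₚ.<⇒≤ (toℕ<n x))) ⟩
    p mod p                             ≡⟨ mod-cong (trans (n%n≡0 p) (sym 0%p≡0)) ⟩
    0#                                  ∎

  +-cancelˡ : ∀ x {y z} → x + y ≡ x + z → y ≡ z
  +-cancelˡ x {y} {z} eq = begin
    y             ≡⟨ shift y ⟨
    - x + (x + y) ≡⟨ cong (- x +_) eq ⟩
    - x + (x + z) ≡⟨ shift z ⟩
    z             ∎
    where
    shift : ∀ w → - x + (x + w) ≡ w
    shift w = trans (sym (+-assoc (- x) x w))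
      (trans (cong (_+ w) (trans (+-comm (- x) x) (-‿inverseʳ x))) (+-identityˡ w))

  +-cancelʳ : ∀ x {y z} → y + x ≡ z + x → y ≡ z
  +-cancelʳ x {y} {z} eq = +-cancelˡ x (trans (+-comm x y) (trans eq (+-comm z x)))

  1≢0 : 1# ≢ 0#
  1≢0 eq = contradiction
    (trans (sym (m<n⇒m%n≡m 1<p)) (trans (sym (toℕ-mod 1)) (trans (cong toℕ eq)
      (trans (toℕ-mod 0) 0%p≡0))))
    λ ()
    where
    1<p : 1 ℕ.< p
    1<p = ℕ.nonTrivial⇒n>1 p {{prime⇒nonTrivial p-prime}}

  ∣⇒≡0 : ∀ x → p ∣ toℕ x → x ≡ 0#
  ∣⇒≡0 x p∣x = trans (sym (mod-toℕ x))
    (mod-cong (trans (n∣m⇒m%n≡0 (toℕ x) p p∣x) (sym 0%p≡0)))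

  -- Euclid's lemma on representatives: primality excludes zero divisors.
  xy≡0⇒x≡0∨y≡0 : ∀ x y → x * y ≡ 0# → x ≡ 0# ⊎ y ≡ 0#
  xy≡0⇒x≡0∨y≡0 x y eq with euclidsLemma (toℕ x) (toℕ y) p-prime (m%n≡0⇒n∣m _ p xy%p≡0)
    where
    xy%p≡0 : (toℕ x ℕ.* toℕ y) % p ≡ 0
    xy%p≡0 = trans (sym (toℕ-mod _)) (trans (cong toℕ eq)
      (trans (toℕ-mod 0) 0%p≡0))
  ... | inj₁ p∣x = inj₁ (∣⇒≡0 x p∣x)
  ... | inj₂ p∣y = inj₂ (∣⇒≡0 y p∣y)

  *-≢0 : ∀ {x y} → x ≢ 0# → y ≢ 0# → x * y ≢ 0#
  *-≢0 {x} {y} x≢0 y≢0 eq with xy≡0⇒x≡0∨y≡0 x y eq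
  ... | inj₁ x≡0 = x≢0 x≡0
  ... | inj₂ y≡0 = y≢0 y≡0

  *-cancelˡ : ∀ {x} → x ≢ 0# → ∀ {y z} → x * y ≡ x * z → y ≡ z
  *-cancelˡ {x} x≢0 {y} {z} eq with xy≡0⇒x≡0∨y≡0 x (y + - z) (begin
      x * (y + - z)     ≡⟨ distribˡ x y (- z) ⟩
      x * y + x * - z   ≡⟨ cong (_+ x * - z) eq ⟩
      x * z + x * - z   ≡⟨ distribˡ x z (- z) ⟨
      x * (z + - z)     ≡⟨ cong (x *_) (-‿inverseʳ z) ⟩
      x * 0#            ≡⟨ zeroʳ x ⟩
      0#                ∎)
  ... | inj₁ x≡0 = contradiction x≡0 x≢0
  ... | inj₂ y-z≡0 = +-cancelʳ (- z) (trans y-z≡0 (sym (-‿inverseʳ z)))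

  -- Multiplication by a nonzero `x` is injective on a finite set, so it takes the value 1.
  inverse : ∀ {x} → x ≢ 0# → ∃ λ y → x * y ≡ 1#
  inverse x≢0 = injective⇒surjective (*-cancelˡ x≢0) 1#

-- Functions on the plane whose line sums are constant in all directions but two

-- Both `b` and `c` are the negation of `a`. If `a` is true, the right side is 0 and the left at
-- least 1; if `a` is false, the right side is 2 and the left at most 1.
𝟙-rectangle : ∀ a b c d → a ≢ b → a ≢ c → 𝟙 a ℕ.+ 𝟙 d ≢ 𝟙 b ℕ.+ 𝟙 c
𝟙-rectangle true  true  _     _     a≢b _   = contradiction refl a≢b
𝟙-rectangle false false _     _     a≢b _   = contradiction refl a≢b
𝟙-rectangle true  false true  _     _   a≢c = contradiction refl a≢c
𝟙-rectangle false true  false _     _   a≢c = contradiction refl a≢c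
𝟙-rectangle true  false false _     _   _   = λ ()
𝟙-rectangle false true  true  true  _   _   = λ ()
𝟙-rectangle false true  true  false _   _   = λ ()

module LineSums (p : ℕ) .{{_ : NonZero p}} (p-prime : Prime p) where

  open AffinePlane p
  open PrimeField p p-prime

  module _ (φ : 𝔽 → 𝔽 → ℕ) where

    rowSum columnSum : 𝔽 → ℕ
    rowSum    y = ∑[ x < p ] φ x y
    columnSum x = ∑[ y < p ] φ x y

    -- Non-vertical lines, parametrised by the first coordinate; the vertical direction is covered
    -- by `columnSum`.
    slopeSum : 𝔽 → 𝔽 → 𝔽 → ℕ
    slopeSum m x y = ∑[ t < p ] φ (x + t) (y + t * m)

    slopeSum-0 : ∀ x y → slopeSum 0# x y ≡ rowSum y
    slopeSum-0 x y = trans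
      (sum-cong-≗ λ t → cong (φ (x + t)) (trans (cong (y +_) (zeroʳ t)) (+-identityʳ y)))
      (sum-reindex (+-cancelˡ x) λ t → φ t y)

    -- The lines through (x , y) meet in that point only and cover the plane.
    pencil : ∀ x y → ∑[ m < p ] slopeSum m x y ℕ.+ columnSum x ≡
                     sum columnSum ℕ.+ p ℕ.* φ x y
    pencil x y = begin
      ∑[ m < p ] slopeSum m x y ℕ.+ columnSum x
        ≡⟨ cong₂ ℕ._+_ (∑-comm {p} {p} _) (cong columnSum (sym (+-identityʳ x))) ⟩
      sum f ℕ.+ columnSum (x + 0#)
        ≡⟨ sum-agree-except f (λ t → columnSum (x + t)) 0# f≗column ⟩
      ∑[ t < p ] columnSum (x + t) ℕ.+ f 0#
        ≡⟨ cong₂ ℕ._+_ (sum-reindex (+-cancelˡ x) columnSum) f0 ⟩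
      sum columnSum ℕ.+ p ℕ.* φ x y ∎
      where
      f : 𝔽 → ℕ
      f t = ∑[ m < p ] φ (x + t) (y + t * m)
      -- For `t ≢ 0#`, `y + t * m` runs once over the field as the slope `m` varies; at `0#` all `p`
      -- slopes give `(x , y)` itself.
      f≗column : ∀ t → t ≢ 0# → f t ≡ columnSum (x + t)
      f≗column t t≢0 = sum-reindex (*-cancelˡ t≢0 ∘ +-cancelˡ y) (φ (x + t))
      f0 : f 0# ≡ p ℕ.* φ x y
      f0 = trans
        (sum-cong-≗ λ m → cong₂ φ (+-identityʳ x)
          (trans (cong (y +_) (zeroˡ m)) (+-identityʳ y)))
        (sum-const p (φ x y))

    module _ (slopeSum-const : ∀ m → m ≢ 0# → ∀ x y → slopeSum m x y ≡ slopeSum m 0# 0#) where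

      -- `C` includes slope 0, whose sum may depend on the base point; the `rowSum 0#` in `K`
      -- compensates for its value at the origin.
      C K : ℕ
      C = ∑[ m < p ] slopeSum m 0# 0#
      K = sum columnSum ℕ.+ rowSum 0#

      -- The pencil at `(x , y)` is compared with the one at the origin: by hypothesis their slope
      -- sums agree except at slope 0, where they are row sums.
      row+column : ∀ x y → rowSum y ℕ.+ columnSum x ℕ.+ C ≡ p ℕ.* φ x y ℕ.+ K
      row+column x y = begin
        rowSum y ℕ.+ columnSum x ℕ.+ C
          ≡⟨ +-*-Solver.solve 3 (λ r c k → r ⊹ c ⊹ k ≔ k ⊹ r ⊹ c) refl
               (rowSum y) (columnSum x) C ⟩
        C ℕ.+ rowSum y ℕ.+ columnSum x
          ≡⟨ cong (λ r → C ℕ.+ r ℕ.+ columnSum x) (slopeSum-0 x y) ⟨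
        C ℕ.+ slopeSum 0# x y ℕ.+ columnSum x
          ≡⟨ cong (ℕ._+ columnSum x) (sum-agree-except (λ m → slopeSum m x y) _ 0#
               λ m m≢0 → slopeSum-const m m≢0 x y) ⟨
        Σslopes ℕ.+ slopeSum 0# 0# 0# ℕ.+ columnSum x
          ≡⟨ cong (λ r → Σslopes ℕ.+ r ℕ.+ columnSum x) (slopeSum-0 0# 0#) ⟩
        Σslopes ℕ.+ rowSum 0# ℕ.+ columnSum x
          ≡⟨ +-*-Solver.solve 3 (λ s r c → s ⊹ r ⊹ c ≔ s ⊹ c ⊹ r) refl
               Σslopes (rowSum 0#) (columnSum x) ⟩
        Σslopes ℕ.+ columnSum x ℕ.+ rowSum 0#
          ≡⟨ cong (ℕ._+ rowSum 0#) (pencil x y) ⟩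
        sum columnSum ℕ.+ p ℕ.* φ x y ℕ.+ rowSum 0#
          ≡⟨ +-*-Solver.solve 3 (λ s q r → s ⊹ q ⊹ r ≔ q ⊹ (s ⊹ r)) refl
               (sum columnSum) (p ℕ.* φ x y) (rowSum 0#) ⟩
        p ℕ.* φ x y ℕ.+ K ∎
        where
        open +-*-Solver using () renaming (_:+_ to infixl 6 _⊹_; _:=_ to infix 4 _≔_)
        Σslopes : ℕ
        Σslopes = ∑[ m < p ] slopeSum m x y

      -- By `row+column`, `p` times `φ` is, up to a constant, a function of `y` plus a function of
      -- `x`, so its mixed second difference vanishes; then `p` is cancelled.
      φ-rectangle : ∀ x x′ y y′ → φ x y ℕ.+ φ x′ y′ ≡ φ x y′ ℕ.+ φ x′ y
      φ-rectangle x x′ y y′ = ℕₚ.*-cancelˡ-≡ _ _ p (ℕₚ.+-cancelʳ-≡ (K ℕ.+ K) _ _ (begin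
        p ℕ.* (φ x y ℕ.+ φ x′ y′) ℕ.+ (K ℕ.+ K)
          ≡⟨ expand (φ x y) (φ x′ y′) ⟩
        (p ℕ.* φ x y ℕ.+ K) ℕ.+ (p ℕ.* φ x′ y′ ℕ.+ K)
          ≡⟨ cong₂ ℕ._+_ (row+column x y) (row+column x′ y′) ⟨
        (rowSum y ℕ.+ columnSum x ℕ.+ C) ℕ.+ (rowSum y′ ℕ.+ columnSum x′ ℕ.+ C)
          ≡⟨ +-*-Solver.solve 5 (λ r c r′ c′ k →
               (r ⊹ c ⊹ k) ⊹ (r′ ⊹ c′ ⊹ k) ≔ (r′ ⊹ c ⊹ k) ⊹ (r ⊹ c′ ⊹ k)) refl
               (rowSum y) (columnSum x) (rowSum y′) (columnSum x′) C ⟩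
        (rowSum y′ ℕ.+ columnSum x ℕ.+ C) ℕ.+ (rowSum y ℕ.+ columnSum x′ ℕ.+ C)
          ≡⟨ cong₂ ℕ._+_ (row+column x y′) (row+column x′ y) ⟩
        (p ℕ.* φ x y′ ℕ.+ K) ℕ.+ (p ℕ.* φ x′ y ℕ.+ K)
          ≡⟨ expand (φ x y′) (φ x′ y) ⟨
        p ℕ.* (φ x y′ ℕ.+ φ x′ y) ℕ.+ (K ℕ.+ K) ∎))
        where
        open +-*-Solver using ()
          renaming (_:+_ to infixl 6 _⊹_; _:*_ to infixl 7 _⊛_; _:=_ to infix 4 _≔_)
        expand : ∀ u v → p ℕ.* (u ℕ.+ v) ℕ.+ (K ℕ.+ K) ≡
                         (p ℕ.* u ℕ.+ K) ℕ.+ (p ℕ.* v ℕ.+ K)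
        expand u v = +-*-Solver.solve 4 (λ q a b k →
          q ⊛ (a ⊹ b) ⊹ (k ⊹ k) ≔ (q ⊛ a ⊹ k) ⊹ (q ⊛ b ⊹ k)) refl p u v K

      -- With `x` fixed, `row+column` determines the row sum from `φ`. Used contrapositively: rows
      -- with different sums differ at every abscissa.
      φ-≡⇒rowSum-≡ : ∀ {x y y′} → φ x y ≡ φ x y′ → rowSum y ≡ rowSum y′
      φ-≡⇒rowSum-≡ {x} {y} {y′} eq = ℕₚ.+-cancelʳ-≡ (columnSum x) _ _ (ℕₚ.+-cancelʳ-≡ C _ _
        (trans (row+column x y) (trans (cong (λ u → p ℕ.* u ℕ.+ K) eq) (sym (row+column x y′)))))

      φ-≡⇒columnSum-≡ : ∀ {x x′ y} → φ x y ≡ φ x′ y → columnSum x ≡ columnSum x′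
      φ-≡⇒columnSum-≡ {x} {x′} {y} eq = ℕₚ.+-cancelˡ-≡ (rowSum y) _ _ (ℕₚ.+-cancelʳ-≡ C _ _
        (trans (row+column x y) (trans (cong (λ u → p ℕ.* u ℕ.+ K) eq) (sym (row+column x′ y)))))

  -- Unequal row sums make `b` change between `y` and `y′`, unequal column sums between `x` and
  -- `x′`. The corner `(x , y)` would then differ from both its neighbours, against the rectangle
  -- identity.
  two-valued : (b : 𝔽 → 𝔽 → Bool) → let φ = λ x y → 𝟙 (b x y) in
    (∀ m → m ≢ 0# → ∀ x y → slopeSum φ m x y ≡ slopeSum φ m 0# 0#) →
    ∀ x x′ y y′ → rowSum φ y ≢ rowSum φ y′ → columnSum φ x ≡ columnSum φ x′
  two-valued b const x x′ y y′ rows≢ =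
    decidable-stable (columnSum φ x ℕₚ.≟ columnSum φ x′) λ columns≢ →
    𝟙-rectangle (b x y) (b x y′) (b x′ y) (b x′ y′)
      (λ eq → rows≢ (φ-≡⇒rowSum-≡ φ const {x} (cong 𝟙 eq)))
      (λ eq → columns≢ (φ-≡⇒columnSum-≡ φ const {y = y} (cong 𝟙 eq)))
      (φ-rectangle φ const x x′ y y′)
    where
    φ : 𝔽 → 𝔽 → ℕ
    φ x y = 𝟙 (b x y)

-- Coordinates along two distinct directions

module Coordinates (p : ℕ) .{{_ : NonZero p}} (p-prime : Prime p)
  (d e : AffinePlane.Direction p) (d≁e : ¬ AffinePlane._∼_ p d e) where

  open AffinePlane p
  open PrimeField p p-prime

  comb : 𝔽 → 𝔽 → Point
  comb x y = x ⊙ vector d ⊕ y ⊙ vector e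

  ⊙-zeroˡ : ∀ v → 0# ⊙ v ≡ 0ᵥ
  ⊙-zeroˡ (a , b) = cong₂ _,_ (zeroˡ a) (zeroˡ b)

  ⊕-identityʳ : ∀ v → v ⊕ 0ᵥ ≡ v
  ⊕-identityʳ (a , b) = cong₂ _,_ (+-identityʳ a) (+-identityʳ b)

  ⊕-cancelˡ : ∀ u {v w} → u ⊕ v ≡ u ⊕ w → v ≡ w
  ⊕-cancelˡ (a , b) eq = cong₂ _,_ (+-cancelˡ a (cong proj₁ eq)) (+-cancelˡ b (cong proj₂ eq))

  ⊙-cancelʳ : ∀ {v} → v ≢ 0ᵥ → ∀ {s t} → s ⊙ v ≡ t ⊙ v → s ≡ t
  ⊙-cancelʳ {a , b} v≢0 {s} {t} eq with a ≟ 0# | b ≟ 0#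
  ... | no a≢0 | _      = *-cancelˡ a≢0 (trans (*-comm a s) (trans (cong proj₁ eq) (*-comm t a)))
  ... | _      | no b≢0 = *-cancelˡ b≢0 (trans (*-comm b s) (trans (cong proj₂ eq) (*-comm t b)))
  ... | yes a≡0 | yes b≡0 = contradiction (cong₂ _,_ a≡0 b≡0) v≢0

  -- In the coordinates of `comb` a line remains a line: the direction `comb u v` becomes the step
  -- `(u , v)`.
  comb-+ : ∀ x y t u v → comb x y ⊕ t ⊙ comb u v ≡ comb (x + t * u) (y + t * v)
  comb-+ x y t u v = cong₂ _,_ (scalar _ _) (scalar _ _)
    where
    scalar : ∀ a b → (x * a + y * b) + t * (u * a + v * b) ≡ (x + t * u) * a + (y + t * v) * b
    scalar a b = solve 7 (λ x y t u v a b →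
      (x :* a :+ y :* b) :+ t :* (u :* a :+ v :* b) :=
      (x :+ t :* u) :* a :+ (y :+ t :* v) :* b) refl x y t u v a b

  ⊙-comb : ∀ c x y → c ⊙ comb x y ≡ comb (c * x) (c * y)
  ⊙-comb c x y = cong₂ _,_ (scalar _ _) (scalar _ _)
    where
    scalar : ∀ a b → c * (x * a + y * b) ≡ (c * x) * a + (c * y) * b
    scalar a b = solve 5 (λ c x y a b →
      c :* (x :* a :+ y :* b) := (c :* x) :* a :+ (c :* y) :* b) refl c x y a b

  comb-1-0 : comb 1# 0# ≡ vector d
  comb-1-0 = cong₂ _,_ (scalar _ _) (scalar _ _)
    where
    scalar : ∀ a b → 1# * a + 0# * b ≡ a
    scalar a b = trans (cong₂ _+_ (*-identityˡ a) (zeroˡ b)) (+-identityʳ a)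

  comb-0-1 : comb 0# 1# ≡ vector e
  comb-0-1 = cong₂ _,_ (scalar _ _) (scalar _ _)
    where
    scalar : ∀ a b → 0# * a + 1# * b ≡ b
    scalar a b = trans (cong₂ _+_ (zeroˡ a) (*-identityˡ b)) (+-identityˡ b)

  comb-0-0 : comb 0# 0# ≡ 0ᵥ
  comb-0-0 = trans (cong₂ _⊕_ (⊙-zeroˡ (vector d)) (⊙-zeroˡ (vector e))) (⊕-identityʳ 0ᵥ)

  -- Linear independence of `d` and `e`: dividing by a nonzero `y` would make `vector e` a multiple
  -- of `vector d`, contradicting `d≁e`.
  comb-kernel : ∀ x y → comb x y ≡ 0ᵥ → x ≡ 0# × y ≡ 0#
  comb-kernel x y eq with y ≟ 0#
  ... | yes refl = ⊙-cancelʳ (nonzero d) xd≡0d , refl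
    where
    xd≡0d : x ⊙ vector d ≡ 0# ⊙ vector d
    xd≡0d = begin
      x ⊙ vector d                  ≡⟨ ⊕-identityʳ _ ⟨
      x ⊙ vector d ⊕ 0ᵥ             ≡⟨ cong (x ⊙ vector d ⊕_) (⊙-zeroˡ (vector e)) ⟨
      x ⊙ vector d ⊕ 0# ⊙ vector e  ≡⟨ eq ⟩
      0ᵥ                            ≡⟨ ⊙-zeroˡ (vector d) ⟨
      0# ⊙ vector d                 ∎
  ... | no y≢0 with z , yz≡1 ← inverse y≢0 = contradiction (c , c≢0 , e≡cd) d≁e
    where
    c : 𝔽
    -- This is `- x` divided by `y`, as `z` inverts `y`.
    c = z * - x
    scalar : ∀ a b → x * a + y * b ≡ 0# → b ≡ c * a
    -- Adding `z * x * a` to both sides lets the negation disappear through `x + - x`.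
    scalar a b xa+yb≡0 = +-cancelˡ (z * x * a) (begin
      z * x * a + b               ≡⟨ cong (z * x * a +_) (*-identityˡ b) ⟨
      z * x * a + 1# * b          ≡⟨ cong (λ w → z * x * a + w * b) yz≡1 ⟨
      z * x * a + y * z * b       ≡⟨ solve 5 (λ x y z a b →
        z :* x :* a :+ y :* z :* b := z :* (x :* a :+ y :* b)) refl x y z a b ⟩
      z * (x * a + y * b)         ≡⟨ cong (z *_) xa+yb≡0 ⟩
      z * 0#                      ≡⟨ cong (z *_) (zeroˡ a) ⟨
      z * (0# * a)                ≡⟨ cong (λ w → z * (w * a)) (-‿inverseʳ x) ⟨
      z * ((x + - x) * a)         ≡⟨ solve 4 (λ x x′ z a →
        z :* ((x :+ x′) :* a) := z :* x :* a :+ z :* x′ :* a) refl x (- x) z a ⟩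
      z * x * a + c * a           ∎)
    e≡cd : vector e ≡ c ⊙ vector d
    e≡cd = cong₂ _,_ (scalar _ _ (cong proj₁ eq)) (scalar _ _ (cong proj₂ eq))
    c≢0 : c ≢ 0#
    c≢0 c≡0 = nonzero e (trans e≡cd (trans (cong (_⊙ vector d) c≡0) (⊙-zeroˡ (vector d))))

  comb-⊕ : ∀ x y u v → comb (x + u) (y + v) ≡ comb x y ⊕ comb u v
  comb-⊕ x y u v = cong₂ _,_ (scalar _ _) (scalar _ _)
    where
    scalar : ∀ a b → (x + u) * a + (y + v) * b ≡ (x * a + y * b) + (u * a + v * b)
    scalar a b = solve 6 (λ x y u v a b →
      (x :+ u) :* a :+ (y :+ v) :* b := (x :* a :+ y :* b) :+ (u :* a :+ v :* b))
      refl x y u v a b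

  comb-injective : ∀ x y x′ y′ → comb x y ≡ comb x′ y′ → x ≡ x′ × y ≡ y′
  comb-injective x y x′ y′ eq
    with x-x′≡0 , y-y′≡0 ← comb-kernel _ _ (begin
      comb (x + - x′) (y + - y′)     ≡⟨ comb-⊕ x y (- x′) (- y′) ⟩
      comb x y ⊕ comb (- x′) (- y′)  ≡⟨ cong (_⊕ comb (- x′) (- y′)) eq ⟩
      comb x′ y′ ⊕ comb (- x′) (- y′) ≡⟨ comb-⊕ x′ y′ (- x′) (- y′) ⟨
      comb (x′ + - x′) (y′ + - y′)   ≡⟨ cong₂ comb (-‿inverseʳ x′) (-‿inverseʳ y′) ⟩
      comb 0# 0#                     ≡⟨ comb-0-0 ⟩
      0ᵥ                             ∎)
    = +-cancelʳ (- x′) (trans x-x′≡0 (sym (-‿inverseʳ x′))) ,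
      +-cancelʳ (- y′) (trans y-y′≡0 (sym (-‿inverseʳ y′)))

  index-injective : ∀ {P Q : Point} → uncurry combine P ≡ uncurry combine Q → P ≡ Q
  index-injective eq = uncurry (cong₂ _,_) (combine-injective _ _ _ _ eq)

  -- An injective self-map of the finite plane is onto, so no determinant has to be inverted. The
  -- map is transported to indices, where the pigeonhole lemma applies.
  comb-surjective : ∀ P → ∃₂ λ x y → comb x y ≡ P
  comb-surjective P = let i , fi≡P = injective⇒surjective f-injective (uncurry combine P) in
    proj₁ (remQuot {p} p i) , proj₂ (remQuot {p} p i) , index-injective fi≡P
    where
    f : Fin (p ℕ.* p) → Fin (p ℕ.* p)
    f i = uncurry combine (uncurry comb (remQuot {p} p i))
    f-injective : Injective _≡_ _≡_ f
    f-injective {i} {j} eq = begin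
      i                              ≡⟨ combine-remQuot {p} p i ⟨
      uncurry combine (remQuot {p} p i)  ≡⟨ cong (uncurry combine)
        (uncurry (cong₂ _,_) (comb-injective _ _ _ _ (index-injective eq))) ⟩
      uncurry combine (remQuot {p} p j)  ≡⟨ combine-remQuot {p} p j ⟩
      j                              ∎

  -- Slope 0 has the vector of `d`; the vertical direction, absent here, is `e`.
  slope : 𝔽 → Direction
  slope m = direction (comb 1# m) λ eq → 1≢0 (proj₁ (comb-kernel 1# m eq))

  -- Second coordinates are compared: `vector d` has 0, a multiple of the slope vector has `c * m`.
  -- Against `e`, the first coordinates decide.
  slope≁d : ∀ m → m ≢ 0# → ¬ slope m ∼ d
  slope≁d m m≢0 (c , c≢0 , eq) = *-≢0 c≢0 m≢0 (sym (proj₂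
    (comb-injective 1# 0# (c * 1#) (c * m) (trans comb-1-0 (trans eq (⊙-comb c 1# m))))))

  slope≁e : ∀ m → ¬ slope m ∼ e
  slope≁e m (c , c≢0 , eq) = *-≢0 c≢0 1≢0 (sym (proj₁
    (comb-injective 0# 1# (c * 1#) (c * m) (trans comb-0-1 (trans eq (⊙-comb c 1# m))))))

  -- Line counts of `S` in the coordinates along `d` and `e`

  module _ (S : PointSet) where

    open LineSums p p-prime

    χ : Point → Bool
    χ P = lookup S (uncurry combine P)

    φ : 𝔽 → 𝔽 → ℕ
    φ x y = 𝟙 (χ (comb x y))

    ∣S∩line∣ : ∀ a f → ∣ S ∩ line a f ∣ ≡ ∑[ t < p ] 𝟙 (χ (a ⊕ t ⊙ vector f))
    ∣S∩line∣ a f = ∣s∩image∣ S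
      -- Distinct parameters give distinct points because the direction vector is nonzero.
      (λ eq → ⊙-cancelʳ (nonzero f) (⊕-cancelˡ a (index-injective eq)))
      (λ i t → ≡-dec _≟_ _≟_ (remQuot p i) (a ⊕ t ⊙ vector f))
      (λ t → remQuot-combine _ _)
      (λ i t eq → trans (sym (combine-remQuot {p} p i)) (cong (uncurry combine) eq))

    ∣S∩line∣-comb : ∀ x y f u v → vector f ≡ comb u v →
      ∣ S ∩ line (comb x y) f ∣ ≡ ∑[ t < p ] φ (x + t * u) (y + t * v)
    ∣S∩line∣-comb x y f u v eq = trans (∣S∩line∣ (comb x y) f)
      (sum-cong-≗ λ t → cong (𝟙 ∘ χ)
        (trans (cong (λ w → comb x y ⊕ t ⊙ w) eq) (comb-+ x y t u v)))

    x+t*0≡x : ∀ x t → x + t * 0# ≡ x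
    x+t*0≡x x t = trans (cong (x +_) (zeroʳ t)) (+-identityʳ x)

    ∣S∩slope∣ : ∀ m x y → ∣ S ∩ line (comb x y) (slope m) ∣ ≡ slopeSum φ m x y
    ∣S∩slope∣ m x y = trans (∣S∩line∣-comb x y (slope m) 1# m refl)
      (sum-cong-≗ λ t → cong (λ s → φ (x + s) (y + t * m)) (*-identityʳ t))

    -- Moving along `d` changes only the first coordinate, so these lines are rows; those along `e`
    -- are columns.
    ∣S∩d∣ : ∀ x y → ∣ S ∩ line (comb x y) d ∣ ≡ rowSum φ y
    ∣S∩d∣ x y = trans (∣S∩line∣-comb x y d 1# 0# (sym comb-1-0)) (trans
      (sum-cong-≗ λ t → cong₂ φ (cong (x +_) (*-identityʳ t)) (x+t*0≡x y t))
      (sum-reindex (+-cancelˡ x) λ t → φ t y))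

    ∣S∩e∣ : ∀ x y → ∣ S ∩ line (comb x y) e ∣ ≡ columnSum φ x
    ∣S∩e∣ x y = trans (∣S∩line∣-comb x y e 0# 1# (sym comb-0-1)) (trans
      (sum-cong-≗ λ t → cong₂ φ (x+t*0≡x x t) (cong (y +_) (*-identityʳ t)))
      (sum-reindex (+-cancelˡ y) (φ x)))

    ∣S∩d∣′ : ∀ P → ∃ λ y → ∣ S ∩ line P d ∣ ≡ rowSum φ y
    ∣S∩d∣′ P = let x , y , eq = comb-surjective P in
      y , trans (cong (λ Q → ∣ S ∩ line Q d ∣) (sym eq)) (∣S∩d∣ x y)

    ∣S∩e∣′ : ∀ P → ∃ λ x → ∣ S ∩ line P e ∣ ≡ columnSum φ x
    ∣S∩e∣′ P = let x , y , eq = comb-surjective P in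
      x , trans (cong (λ Q → ∣ S ∩ line Q e ∣) (sym eq)) (∣S∩e∣ x y)

    module _ (special : ∀ f → Special S f → f ∼ d ⊎ f ∼ e) where

      -- A nonzero slope is neither `d` nor `e`, hence not special. This only yields
      -- equidistribution doubly negated; decidability of equality in ℕ removes the negations.
      slopeSum-const : ∀ m → m ≢ 0# → ∀ x y → slopeSum φ m x y ≡ slopeSum φ m 0# 0#
      slopeSum-const m m≢0 x y = decidable-stable (slopeSum φ m x y ℕₚ.≟ slopeSum φ m 0# 0#) λ ≢ →
        excluded (special (slope m) λ equi → ≢ (trans (sym (∣S∩slope∣ m x y))
          (trans (equi (comb x y) (comb 0# 0#)) (∣S∩slope∣ m 0# 0#))))
        where
        excluded : ¬ (slope m ∼ d ⊎ slope m ∼ e)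
        excluded (inj₁ ∼d) = slope≁d m m≢0 ∼d
        excluded (inj₂ ∼e) = slope≁e m ∼e

      d-lines≢⇒e-lines≡ : ∀ a b → ∣ S ∩ line a d ∣ ≢ ∣ S ∩ line b d ∣ → Equidistributed S e
      d-lines≢⇒e-lines≡ a b a≢b a′ b′ =
        let y  , a-row    = ∣S∩d∣′ a
            y′ , b-row    = ∣S∩d∣′ b
            x  , a′-column = ∣S∩e∣′ a′
            x′ , b′-column = ∣S∩e∣′ b′
        in trans a′-column (trans
          (two-valued (λ x y → χ (comb x y)) slopeSum-const x x′ y y′ λ eq →
            a≢b (trans a-row (trans eq (sym b-row))))
          (sym b′-column))

mainTheorem2 : ∀ (p : ℕ) .{{_ : NonZero p}} → Prime p →
    let open AffinePlane p in
    ¬ (∃ λ (S : PointSet) → (p ∣ ∣ S ∣) × ExactlyTwoSpecialDirections S)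
mainTheorem2 p p-prime (S , _ , d , e , d≁e , d-special , e-special , special) =
  -- Two unequal `d`-lines would make `S` equidistributed along `e`, against `e-special`; so all
  -- `d`-lines agree, against `d-special`.
  d-special λ a b → decidable-stable (∣ S ∩ line a d ∣ ℕₚ.≟ ∣ S ∩ line b d ∣) λ ≢ →
    e-special (d-lines≢⇒e-lines≡ S special a b ≢)
  where
  open AffinePlane p
  open Coordinates p p-prime d e d≁e
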